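{- There exists an ideal $\mathcal{I}$ on an infinite countable set $X$ such that: (1) $\mathcal{I}$ is a $\mathbf{\Sigma^0_6}$ subset of $\mathcal{P}(X)$; (2) there is no $P^+$-ideal $\mathcal{J}$ on $X$ with $\mathcal{I}\subseteq\mathcal{J}$; (3) $\mathrm{conv}\not\leq_K\mathcal{I}$.
   Context: An ideal on an infinite countable set $X$ is a family $\mathcal{I}\subseteq\mathcal{P}(X)$ closed under subsets and finite unions, containing all finite subsets of $X$, and with $\mathcal{I}\neq\mathcal{P}(X)$ (so $X=\bigcup\mathcal{I}$). The power set $\mathcal{P}(X)$ is identified with $2^X$ (product topology, $2=\{0,1\}$ discrete) via characteristic functions, and descriptive complexity of ideals on $X$ (e.g. being $\mathbf{\Sigma^0_6}$) refers to this topology. An ideal $\mathcal{J}$ on $X$ is a $P^+$-ideal if for every decreasing sequence $(A_n)_{n\in\omega}$ ($A_{n+1}\subseteq A_n$) of subsets of $X$ not belonging to $\mathcal{J}$ there is $B\subseteq X$ with $B\notin\mathcal{J}$ such that $B\setminus A_n$ is finite for all $n\in\omega$. Katětov preorder: for ideals $\mathcal{I},\mathcal{J}$, $\mathcal{I}\leq_K\mathcal{J}$ means there is a function $f:\bigcup\mathcal{J}\to\bigcup\mathcal{I}$ such that $f^{ -1}[A]\in\mathcal{J}$ for each $A\in\mathcal{I}$. $\mathrm{conv}$ is the ideal on $\mathbb{Q}\cap[0,1]$ consisting of all sets $A\subseteq\mathbb{Q}\cap[0,1]$ that can be covered by (the sets of terms of) finitely many sequences in $\mathbb{Q}\cap[0,1]$,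 each convergent in $[0,1]$. -}

module Defs where

open import Level using (Level; 0ℓ; suc)
open import Data.Bool.Base using (Bool; T)
open import Data.Fin.Base using (Fin)
open import Data.List.Base using (List)
open import Data.List.Membership.Propositional using () renaming (_∈_ to _∈ˡ_)
open import Data.List.Relation.Unary.All using (All)
open import Data.Nat.Base as ℕ using (ℕ)
open import Data.Product.Base using (∃; ∃-syntax; Σ-syntax; _×_; proj₁)
open import Data.Rational.Base using (ℚ; 0ℚ; 1ℚ; _+_; _-_; _<_; _≤_)
open import Data.Sum.Base using (_⊎_)
open import Function.Base using (_∘_)
open import Function.Bundles using (_⇔_)
open import Relation.Binary.PropositionalEquality.Core using (_≡_)
open import Relation.Nullary.Negation.Core using (¬_)
open import Relation.Unary
  using (Pred; _∈_; _∉_; _⊆_; _≐_; _∪_; _∖_; ∁; ⋃; _⊢_; Satisfiable; Universal)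

private
  variable
    ℓ ℓ′ : Level
    X    : Set

------------------------------------------------------------------------
-- Ideals

𝒫 : Set → Set₁
𝒫 X = Pred X 0ℓ

-- Being covered by a list; classically this is finiteness in the usual
-- sense.
Finite : 𝒫 X → Set
Finite {X} A = Σ[ xs ∈ List X ] A ⊆ (_∈ˡ xs)

record IsIdeal {X : Set} (I : Pred (𝒫 X) ℓ) : Set (suc 0ℓ Level.⊔ ℓ) where
  field
    downward : ∀ {A B} → A ⊆ B → B ∈ I → A ∈ I
    union    : ∀ {A B} → A ∈ I → B ∈ I → (A ∪ B) ∈ I
    finite   : ∀ {A} → Finite A → A ∈ I
    proper   : ¬ Universal I

IsP⁺ : {X : Set} → Pred (𝒫 X) ℓ → Set (suc 0ℓ Level.⊔ ℓ)
IsP⁺ {X = X} J =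
  (A : ℕ → 𝒫 X) →
  (∀ n → A (ℕ.suc n) ⊆ A n) →
  (∀ n → A n ∉ J) →
  Σ[ B ∈ 𝒫 X ] B ∉ J × (∀ n → Finite (B ∖ A n))

IsP⁺Ideal : {X : Set} → Pred (𝒫 X) ℓ → Set (suc 0ℓ Level.⊔ ℓ)
IsP⁺Ideal J = IsIdeal J × IsP⁺ J

-- The Katětov preorder.  For ideals ⋃ I and ⋃ J are the whole underlying
-- sets X and Y, and f ⊢ A is the preimage of A under f.
infix 4 _≤K_

_≤K_ : {X Y : Set} → Pred (𝒫 X) ℓ → Pred (𝒫 Y) ℓ′ → Set (suc 0ℓ Level.⊔ ℓ Level.⊔ ℓ′)
_≤K_ {X = X} {Y = Y} I J = Σ[ f ∈ (Y → X) ] (∀ A → A ∈ I → (f ⊢ A) ∈ J)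

------------------------------------------------------------------------
-- The Borel hierarchy of finite rank on 2^X

-- The product topology: the sets { ψ ∣ ψ agrees with χ on F }, with F a
-- finite subset of X, form a neighbourhood base at χ.
Open : Pred (X → Bool) 0ℓ → Set
Open {X} U = ∀ χ → χ ∈ U →
  Σ[ F ∈ List X ] (∀ ψ → All (λ x → ψ x ≡ χ x) F → ψ ∈ U)

-- Σ⁰ n U says that U is Σ⁰ₙ, for n ≥ 1; no set is Σ⁰₀.  Σ⁰ₙ sets with
-- n > 1 are the countable unions of sets V k that are Π⁰ of some rank
-- m k < n, i.e. have Σ⁰ complement.
data Σ⁰ {X : Set} : ℕ → Pred (X → Bool) 0ℓ → Set₁ where
  isOpen : ∀ {U} → Open U → Σ⁰ 1 U
  ⋃Π⁰    : ∀ {n U} (m : ℕ → ℕ) (V : ℕ → Pred (X → Bool) 0ℓ) →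
           (∀ k → m k ℕ.< n) →
           (∀ k → Σ⁰ (m k) (∁ (V k))) →
           U ≐ ⋃[ k ∶ ℕ ] V k →
           Σ⁰ n U

-- A family of subsets of X, seen as a subset of 2^X by identifying a
-- subset with its characteristic function.
charFamily : Pred (𝒫 X) 0ℓ → Pred (X → Bool) 0ℓ
charFamily I χ = (T ∘ χ) ∈ I

------------------------------------------------------------------------
-- The ideal conv

-- Dedekind reals.
record ℝ : Set₁ where
  field
    lower upper     : Pred ℚ 0ℓ
    lower-inhabited : Satisfiable lower
    upper-inhabited : Satisfiable upper
    lower-rounded   : ∀ q → q ∈ lower ⇔ (∃[ r ] q < r × r ∈ lower)
    upper-rounded   : ∀ q → q ∈ upper ⇔ (∃[ r ] r < q × r ∈ upper)
    disjoint        : ∀ q → ¬ (q ∈ lower × q ∈ upper)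
    located         : ∀ q r → q < r → q ∈ lower ⊎ r ∈ upper

open ℝ

-- q ∈ lower x means q < x and q ∈ upper x means x < q, so this is
-- 0 ≤ x ≤ 1.
InUnitInterval : ℝ → Set
InUnitInterval x = 0ℚ ∉ upper x × 1ℚ ∉ lower x

-- ℚ ∩ [0,1]
ℚ[0,1] : Set
ℚ[0,1] = ∃[ q ] 0ℚ ≤ q × q ≤ 1ℚ

-- The last line is s n − ε < x < s n + ε, i.e. ∣ s n − x ∣ < ε.
_ConvergesTo_ : (ℕ → ℚ[0,1]) → ℝ → Set
s ConvergesTo x = ∀ ε → 0ℚ < ε → ∃[ N ] ∀ n → N ℕ.≤ n →
  (proj₁ (s n) - ε) ∈ lower x × (proj₁ (s n) + ε) ∈ upper x

Convergent : (ℕ → ℚ[0,1]) → Set₁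
Convergent s = Σ[ x ∈ ℝ ] InUnitInterval x × s ConvergesTo x

range : (ℕ → X) → 𝒫 X
range s x = ∃[ n ] s n ≡ x

conv : Pred (𝒫 ℚ[0,1]) (suc 0ℓ)
conv A = Σ[ k ∈ ℕ ] Σ[ s ∈ (Fin k → ℕ → ℚ[0,1]) ]
  (∀ i → Convergent (s i)) × A ⊆ ⋃[ i ∶ Fin k ] range (s i)

{-# OPTIONS --safe #-}
module Submission where

-- Nodes are finite binary words and ⊂ is "is a prefix of".  A set A is in the ideal when it
-- accumulates at finitely many branches α only and, for each of them, along all but finitely
-- many "gaps" k, only finitely many s ∈ A satisfy s 0ᵏ 1 ⊂ α (a copy of Fin ⊗ Fin on the
-- prefixes of α).
--
-- No P⁺ extension: an ideal J ⊇ I has a branch α with all cones over the prefixes of α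
-- J-positive, and a pseudo-intersection B ∉ J of these cones.  Since B converges to α, the
-- sets Aₙ = { s ∣ s 0ᵏ 1 ⊂ α for some k ≥ n } are J-positive too; but each of their
-- pseudo-intersections is in I.
--
-- conv ≰ I: given f, choose nodes sₙ and intervals of width 2⁻ⁿ, decreasing, such that f takes
-- values in the n-th interval densely above sₙ; pick uₙ ⊒ sₙ with f(uₙ) in the interval, and
-- sₙ₊₁ ⊒ uₙ 0ᵏ 1, where k = k(n) assumes every value infinitely often.  The f(uₙ) converge, but
-- no set containing all uₙ is in I.
--
-- Complexity: call u live if A has infinitely many elements above u, a Π⁰₂ condition.  Then
-- A ∈ I iff for some N and all x of length k ≥ N, x0 and x1 are not both live, and only
-- finitely many s ∈ A have s 0ᵏ 1 live.

open import Defs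
open import Level using (0ℓ)
open import Axiom.ExcludedMiddle using (ExcludedMiddle)
open import Data.Bool.Base using (Bool; true; false; not; T)
import Data.Bool.Properties as Bool
open import Data.Empty using (⊥-elim)
open import Data.Fin.Base using () renaming (zero to fzero)
open import Data.Integer.Base as ℤ using (+_; +[1+_])
open import Data.List.Base using (List; []; _∷_; [_]; _++_; length; replicate)
open import Data.List.Properties using (length-++; length-replicate)
open import Data.List.Membership.Propositional using () renaming (_∈_ to _∈ˡ_)
open import Data.List.Relation.Unary.All using ([]; _∷_)
open import Data.List.Relation.Unary.All.Properties using (++⁻ˡ; ++⁻ʳ)
open import Data.List.Relation.Unary.Any as Any using (Any; here; there)
open import Data.List.Relation.Unary.Any.Properties using (++⁺ˡ; ++⁺ʳ)
open import Data.Nat.Base as ℕ using (ℕ; zero; suc; z≤n; s≤s; _⊔_)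
open import Data.Nat.Binary.Base as ℕᵇ using (ℕᵇ; 2[1+_]; 1+[2_])
import Data.Nat.Binary.Properties as ℕᵇ
open import Data.Nat.Properties as ℕ using (≤-trans; ≤-refl; m≤m⊔n; m≤n⊔m)
open import Data.Product.Base using (∃; ∃-syntax; Σ-syntax; _×_; _,_; proj₁; proj₂)
open import Data.Rational.Base as ℚ using (ℚ; 0ℚ; 1ℚ; ½; mkℚ)
import Data.Rational.Properties as ℚ
open import Data.Rational.Unnormalised.Base as ℚᵘ using (mkℚᵘ; *<*)
import Data.Rational.Unnormalised.Properties as ℚᵘ
open import Data.Sum.Base using (_⊎_; inj₁; inj₂; [_,_]′)
open import Function.Base using (_∘_; id)
open import Function.Bundles using (_↔_; mk↔ₛ′; mk⇔; Inverse)
open import Relation.Binary.PropositionalEquality using (_≡_; refl; sym; trans; cong; subst)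
open import Relation.Nullary.Decidable.Core using (yes; no; decidable-stable)
open import Relation.Nullary.Negation.Core using (¬_; contradiction)
open import Relation.Unary using (Pred; _∈_; _∉_; _⊢_; _⊆_; _≐_; _∪_; _∩_; _∖_; ∁)

-- Binary words, branches and gaps.

-- Words are stored last letter first, so the children of s are the b ∷ s and ⊑ is the suffix order.
Node Branch : Set
Node   = List Bool
Branch = ℕ → Bool

infix 4 _⊑_ _≺_

data _⊑_ (u : Node) : Node → Set where
  stop : u ⊑ u
  step : ∀ {b v} → u ⊑ v → u ⊑ b ∷ v

⊑-trans : ∀ {u v w} → u ⊑ v → v ⊑ w → u ⊑ w
⊑-trans p stop     = p
⊑-trans p (step q) = step (⊑-trans p q)

⊑-length : ∀ {u v} → u ⊑ v → length u ℕ.≤ length v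
⊑-length stop     = ≤-refl
⊑-length (step p) = ℕ.m≤n⇒m≤1+n (⊑-length p)

⊑-linear : ∀ {u v w} → u ⊑ w → v ⊑ w → length u ℕ.≤ length v → u ⊑ v
⊑-linear p        stop     _ = p
⊑-linear stop     (step q) l = contradiction (≤-trans l (⊑-length q)) ℕ.1+n≰n
⊑-linear (step p) (step q) l = ⊑-linear p q l

⊑-≡ : ∀ {u v} → u ⊑ v → length v ℕ.≤ length u → u ≡ v
⊑-≡ stop     _ = refl
⊑-≡ (step p) l = contradiction (≤-trans l (⊑-length p)) ℕ.1+n≰n

[]⊑ : ∀ s → [] ⊑ s
[]⊑ []      = stop
[]⊑ (_ ∷ s) = step ([]⊑ s)

⊑-++ : ∀ t s → s ⊑ t ++ s
⊑-++ []      s = stop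
⊑-++ (_ ∷ t) s = step (⊑-++ t s)

⊑-child : ∀ {u s} → u ⊑ s → s ≡ u ⊎ (∃[ b ] b ∷ u ⊑ s)
⊑-child stop = inj₁ refl
⊑-child (step {b} p) with ⊑-child p
... | inj₁ refl    = inj₂ (b , stop)
... | inj₂ (c , q) = inj₂ (c , step q)

⊑-cons : ∀ {u b v} → u ⊑ b ∷ v → u ≡ b ∷ v ⊎ u ⊑ v
⊑-cons stop     = inj₁ refl
⊑-cons (step p) = inj₂ p

cone : Node → 𝒫 Node
cone u s = u ⊑ s

res : Branch → ℕ → Node
res α zero    = []
res α (suc n) = α n ∷ res α n

length-res : ∀ α n → length (res α n) ≡ n
length-res α zero    = refl
length-res α (suc n) = cong suc (length-res α n)

res-mono : ∀ α {m n} → m ℕ.≤ n → res α m ⊑ res α n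
res-mono α m≤n = go (ℕ.≤⇒≤′ m≤n)
  where
  go : ∀ {m n} → m ℕ.≤′ n → res α m ⊑ res α n
  go (ℕ.≤′-reflexive refl) = stop
  go (ℕ.≤′-step p)         = step (go p)

_≺_ : Node → Branch → Set
s ≺ α = res α (length s) ≡ s

res⊑-≺ : ∀ {α u s} → res α (length u) ⊑ s → u ⊑ s → u ≺ α
res⊑-≺ {α} {u} p q = ⊑-≡ (⊑-linear p q (ℕ.≤-reflexive (length-res α _)))
                         (ℕ.≤-reflexive (sym (length-res α _)))

res-≡ : ∀ {α β n s} → res α n ⊑ s → res β n ⊑ s → res α n ≡ res β n
res-≡ {α} {β} {n} p q = ⊑-≡ (⊑-linear p q (ℕ.≤-reflexive same-length))
                            (ℕ.≤-reflexive (sym same-length))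
  where
  same-length : length (res α n) ≡ length (res β n)
  same-length = trans (length-res α n) (sym (length-res β n))

≺-res⊑ : ∀ {α s m} → s ≺ α → m ℕ.≤ length s → res α m ⊑ s
≺-res⊑ {α} {s} {m} s≺α l = subst (res α m ⊑_) s≺α (res-mono α l)

⊑-≺ : ∀ {α u v} → u ⊑ v → v ≺ α → u ≺ α
⊑-≺ p v≺α = res⊑-≺ (≺-res⊑ v≺α (⊑-length p)) p

-- s ▹ k is the word s 0ᵏ 1.
infixl 6 _▹_

_▹_ : Node → ℕ → Node
s ▹ k = true ∷ (replicate k false ++ s)

⊑-▹ : ∀ s k → s ⊑ s ▹ k
⊑-▹ s k = step (⊑-++ (replicate k false) s)

length-▹ : ∀ s k → length (s ▹ k) ≡ suc (k ℕ.+ length s)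
length-▹ s k = cong suc (trans (length-++ (replicate k false))
                               (cong (ℕ._+ length s) (length-replicate k)))

-- Of two prefixes of `α` the shorter is a prefix of the longer. Between `s` and the last letter of
-- `s ▹ k` there are only zeros, so the final 1 of `s ▹ j` must be that last letter.
▹-unique-≤ : ∀ {α s j k} → j ℕ.≤ k → s ▹ j ≺ α → s ▹ k ≺ α → j ≡ k
▹-unique-≤ {α} {s} {j} {k} j≤k p q = top (⊑-cons (subst (_⊑ s ▹ k) p (≺-res⊑ q l)))
  where
  l : length (s ▹ j) ℕ.≤ length (s ▹ k)
  l rewrite length-▹ s j | length-▹ s k = s≤s (ℕ.+-monoˡ-≤ _ j≤k)

  skip : ∀ i → ¬ s ▹ j ⊑ replicate i false ++ s
  skip zero    r        = ℕ.1+n≰n (≤-trans (s≤s (⊑-length (⊑-++ (replicate j false) s))) (⊑-length r))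
  skip (suc i) (step r) = skip i r

  top : s ▹ j ≡ s ▹ k ⊎ s ▹ j ⊑ replicate k false ++ s → j ≡ k
  top (inj₂ r) = ⊥-elim (skip k r)
  top (inj₁ e) = ℕ.+-cancelʳ-≡ (length s) j k (ℕ.suc-injective
    (trans (sym (length-▹ s j)) (trans (cong length e) (length-▹ s k))))

▹-unique : ∀ {α s j k} → s ▹ j ≺ α → s ▹ k ≺ α → j ≡ k
▹-unique {j = j} {k} p q with ℕ.≤-total j k
... | inj₁ j≤k = ▹-unique-≤ j≤k p q
... | inj₂ k≤j = sym (▹-unique-≤ k≤j q p)

-- Finiteness of sets of words, as boundedness of length.

-- Equivalent to finiteness, as there are finitely many words of each length.
Bounded : 𝒫 Node → Set
Bounded P = ∃[ l ] (∀ s → l ℕ.≤ length s → s ∉ P)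

module _ {P Q : 𝒫 Node} where

  Bounded-⊆ : P ⊆ Q → Bounded Q → Bounded P
  Bounded-⊆ P⊆Q (l , q) = l , λ s l≤s → q s l≤s ∘ P⊆Q

  Bounded-∪ : Bounded P → Bounded Q → Bounded (P ∪ Q)
  Bounded-∪ (l , p) (m , q) = l ⊔ m , λ s b →
    [ p s (≤-trans (m≤m⊔n l m) b) , q s (≤-trans (m≤n⊔m l m) b) ]′

Bounded-beyond : ∀ {P} m → Bounded (λ s → s ∈ P × m ℕ.≤ length s) → Bounded P
Bounded-beyond m (l , p) = m ⊔ l , λ s b x →
  p s (≤-trans (m≤n⊔m m l) b) (x , ≤-trans (m≤m⊔n m l) b)

Bounded-Any : {A : Set} {P : A → 𝒫 Node} (xs : List A) → (∀ x → x ∈ˡ xs → Bounded (P x)) →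
              Bounded (λ s → Any (λ x → s ∈ P x) xs)
Bounded-Any []       h = 0 , λ _ _ ()
Bounded-Any (x ∷ xs) h = Bounded-⊆ Any.toSum
  (Bounded-∪ (h x (here refl)) (Bounded-Any xs (λ y → h y ∘ there)))

Finite⇒Bounded : ∀ {P} → Finite P → Bounded P
Finite⇒Bounded (xs , P⊆xs) = Bounded-⊆ P⊆xs (Bounded-Any xs λ x _ →
  suc (length x) , λ { s l refl → ℕ.1+n≰n l })

EventuallyBounded : (ℕ → 𝒫 Node) → Set
EventuallyBounded P = ∃[ K ] (∀ k → K ℕ.≤ k → Bounded (P k))

EventuallyBounded-Any : {A : Set} {P : A → ℕ → 𝒫 Node} (xs : List A) →
                        (∀ x → EventuallyBounded (P x)) →
                        EventuallyBounded (λ k s → Any (λ x → s ∈ P x k) xs)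
EventuallyBounded-Any []       h = 0 , λ _ _ → 0 , λ _ _ ()
EventuallyBounded-Any (x ∷ xs) h =
  let K , f = h x ; L , g = EventuallyBounded-Any xs h in
  K ⊔ L , λ k l → Bounded-⊆ Any.toSum
    (Bounded-∪ (f k (≤-trans (m≤m⊔n K L) l)) (g k (≤-trans (m≤n⊔m K L) l)))

-- The ideal.

-- Since `gaps` speaks of every branch and not just of the listed ones, it passes to unions branch
-- by branch, whatever the two lists are.
record 𝓘 (A : 𝒫 Node) : Set where
  field
    branches : List Branch
    converge : ∀ m → Bounded (λ s → s ∈ A × ¬ Any (λ α → res α m ⊑ s) branches)
    gaps     : ∀ α → EventuallyBounded (λ k s → s ∈ A × s ▹ k ≺ α)

open 𝓘

𝓘-downward : ∀ {A B} → A ⊆ B → B ∈ 𝓘 → A ∈ 𝓘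
𝓘-downward A⊆B b = record
  { branches = branches b
  ; converge = λ m → Bounded-⊆ (λ (a , n) → A⊆B a , n) (converge b m)
  ; gaps     = λ α → let K , h = gaps b α in
      K , λ k K≤k → Bounded-⊆ (λ (a , n) → A⊆B a , n) (h k K≤k)
  }

𝓘-union : ∀ {A B} → A ∈ 𝓘 → B ∈ 𝓘 → (A ∪ B) ∈ 𝓘
𝓘-union a b = record
  { branches = branches a ++ branches b
  ; converge = λ m → Bounded-⊆
      (λ { (inj₁ x , n) → inj₁ (x , n ∘ ++⁺ˡ) ; (inj₂ x , n) → inj₂ (x , n ∘ ++⁺ʳ (branches a)) })
      (Bounded-∪ (converge a m) (converge b m))
  ; gaps     = λ α → let K , f = gaps a α ; L , g = gaps b α in
      K ⊔ L , λ k l → Bounded-⊆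
        (λ { (inj₁ x , p) → inj₁ (x , p) ; (inj₂ x , p) → inj₂ (x , p) })
        (Bounded-∪ (f k (≤-trans (m≤m⊔n K L) l)) (g k (≤-trans (m≤n⊔m K L) l)))
  }

𝓘-finite : ∀ {A} → Finite A → A ∈ 𝓘
𝓘-finite fin = record
  { branches = []
  ; converge = λ m → Bounded-⊆ proj₁ (Finite⇒Bounded fin)
  ; gaps     = λ α → 0 , λ k _ → Bounded-⊆ proj₁ (Finite⇒Bounded fin)
  }

-- No P⁺-ideal extends the ideal.

module _ (em : ExcludedMiddle 0ℓ) where

  dne : {P : Set} → ¬ ¬ P → P
  dne = decidable-stable em

  ¬∃¬⇒∀ : {A : Set} (P : A → Set) → ¬ (∃[ x ] ¬ P x) → ∀ x → P x
  ¬∃¬⇒∀ P none x = dne λ ¬p → none (x , ¬p)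

  ¬∀⇒∃¬ : {A : Set} {P : A → Set} → ¬ (∀ x → P x) → ∃[ x ] ¬ P x
  ¬∀⇒∃¬ ¬all = dne λ none → ¬all λ x → dne λ ¬p → none (x , ¬p)

  ∪-∖ : (B A : 𝒫 Node) → B ⊆ (A ∪ (B ∖ A))
  ∪-∖ B A {s} s∈B with em {s ∈ A}
  ... | yes p = inj₁ p
  ... | no  p = inj₂ (s∈B , p)

  branch : (P : 𝒫 Node) → [] ∈ P → (∀ s → s ∈ P → ∃[ b ] (b ∷ s) ∈ P) →
           ∃[ α ] (∀ n → res α n ∈ P)
  branch P p₀ next = α , λ n → subst P (node≡res n) (proj₂ (path n))
    where
    path : ℕ → ∃ P
    path zero    = [] , p₀
    path (suc n) = let s , p = path n ; b , q = next s p in b ∷ s , q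

    α : Branch
    α n = let s , p = path n in proj₁ (next s p)

    node≡res : ∀ n → proj₁ (path n) ≡ res α n
    node≡res zero    = refl
    node≡res (suc n) = cong (α n ∷_) (node≡res n)

  infix 4 _→ᵇ_

  _→ᵇ_ : 𝒫 Node → Branch → Set
  B →ᵇ α = ∀ m → Bounded (B ∖ cone (res α m))

  -- Any other branch `β` leaves `α` at some level `i`; long prefixes of `β` then avoid the cone of
  -- `res α i`, outside which `B` is bounded.
  →ᵇ∧gaps⇒𝓘 : ∀ {B α} → B →ᵇ α → EventuallyBounded (λ k s → s ∈ B × s ▹ k ≺ α) → B ∈ 𝓘
  →ᵇ∧gaps⇒𝓘 {B} {α} B→α gap = record
    { branches = [ α ]
    ; converge = λ m → Bounded-⊆ (λ (x , n) → x , n ∘ here) (B→α m)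
    ; gaps     = other
    }
    where
    other : ∀ β → EventuallyBounded (λ k s → s ∈ B × s ▹ k ≺ β)
    other β with em {∃[ i ] ¬ res α i ≡ res β i}
    ... | yes (i , α≢β) = 0 , λ k _ → Bounded-beyond i (Bounded-⊆
      (λ {s} ((s∈B , p) , i≤s) → s∈B , λ q → α≢β (res-≡ q (≺-res⊑ (⊑-≺ (⊑-▹ s k) p) i≤s)))
      (B→α i))
    ... | no α≡β = let K , h = gap in K , λ k K≤k → Bounded-⊆
      (λ { {s} (x , p) → x , trans (dne (λ n → α≡β (length (s ▹ k) , n))) p }) (h k K≤k)

  not-extendable : ¬ (Σ[ J ∈ Pred (𝒫 Node) 0ℓ ] IsP⁺Ideal J × 𝓘 ⊆ J)
  not-extendable (J , (J-ideal , P⁺) , 𝓘⊆J) = B′∉J (𝓘⊆J B′∈𝓘)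
    where
    open IsIdeal J-ideal

    -- A cone consists of its root and the cones of the two children, so a positive cone has a
    -- positive child. Properness starts the recursion.
    α-cones : ∃[ α ] (∀ n → cone (res α n) ∉ J)
    α-cones = branch (λ s → cone s ∉ J)
      (λ all → proper λ A → downward (λ {s} _ → []⊑ s) all)
      λ s s∉J → dne λ none → s∉J (downward split (union (finite ([ s ] , id))
        (union (dne λ n → none (false , n)) (dne λ n → none (true , n)))))
      where
      split : ∀ {s} → cone s ⊆ ((_∈ˡ [ s ]) ∪ (cone (false ∷ s) ∪ cone (true ∷ s)))
      split p with ⊑-child p
      ... | inj₁ e           = inj₁ (here e)
      ... | inj₂ (false , q) = inj₂ (inj₁ q)
      ... | inj₂ (true  , q) = inj₂ (inj₂ q)

    α = proj₁ α-cones

    pseudo = P⁺ (λ n → cone (res α n)) (λ n → ⊑-trans (step stop)) (proj₂ α-cones)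
    B = proj₁ pseudo

    B→α : B →ᵇ α
    B→α n = Finite⇒Bounded (proj₂ (proj₂ pseudo) n)

    A : ℕ → 𝒫 Node
    A n s = ∃[ k ] n ℕ.≤ k × s ▹ k ≺ α

    -- What remains of `B` outside `A n` converges to `α` and has no elements at gaps from `n` on,
    -- so it is in `𝓘`; if `A n` were in `J`, so would be `B`.
    A∉J : ∀ n → A n ∉ J
    A∉J n n∈J = proj₁ (proj₂ pseudo) (downward (∪-∖ B (A n)) (union n∈J (𝓘⊆J rest)))
      where
      rest : (B ∖ A n) ∈ 𝓘
      rest = →ᵇ∧gaps⇒𝓘 (λ m → Bounded-⊆ (λ ((x , _) , n) → x , n) (B→α m))
        (n , λ k n≤k → 0 , λ s _ ((_ , ∉A) , p) → ∉A (k , n≤k , p))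

    pseudo′ = P⁺ A (λ n (k , l , p) → k , ℕ.<⇒≤ l , p) A∉J
    B′ = proj₁ pseudo′

    B′∉J : B′ ∉ J
    B′∉J = proj₁ (proj₂ pseudo′)

    B′∖A : ∀ n → Bounded (B′ ∖ A n)
    B′∖A n = Finite⇒Bounded (proj₂ (proj₂ pseudo′) n)

    -- Almost all of `B′` lies in `A 0`, hence on `α`. An element with gap `k` is not in
    -- `A (suc k)`, because its gap is unique, so there are only finitely many of these.
    B′∈𝓘 : B′ ∈ 𝓘
    B′∈𝓘 = →ᵇ∧gaps⇒𝓘
      (λ m → Bounded-beyond m (Bounded-⊆
        (λ {s} ((x , n) , m≤s) → x , λ (k , _ , p) → n (≺-res⊑ (⊑-≺ (⊑-▹ s k) p) m≤s))
        (B′∖A 0)))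
      (0 , λ k _ → Bounded-⊆
        (λ (x , p) → x , λ (j , k<j , q) → ℕ.<⇒≢ k<j (▹-unique p q)) (B′∖A (suc k)))

-- Enumerations and closure properties of the Borel classes.

-- `ℕᵇ` is bijective base-2 notation: its two digits serve as the two letters.
Node↔ℕ : Node ↔ ℕ
Node↔ℕ = mk↔ₛ′ (ℕᵇ.toℕ ∘ to) (from ∘ ℕᵇ.fromℕ)
  (λ n → trans (cong ℕᵇ.toℕ (to∘from (ℕᵇ.fromℕ n))) (ℕᵇ.toℕ-fromℕ n))
  (λ s → trans (cong from (ℕᵇ.fromℕ-toℕ (to s))) (from∘to s))
  where
  to : Node → ℕᵇ
  to []          = ℕᵇ.zero
  to (false ∷ s) = 2[1+ to s ]
  to (true  ∷ s) = 1+[2 to s ]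

  from : ℕᵇ → Node
  from ℕᵇ.zero   = []
  from 2[1+ n ] = false ∷ from n
  from 1+[2 n ] = true ∷ from n

  to∘from : ∀ n → to (from n) ≡ n
  to∘from ℕᵇ.zero   = refl
  to∘from 2[1+ n ] = cong 2[1+_] (to∘from n)
  to∘from 1+[2 n ] = cong 1+[2_] (to∘from n)

  from∘to : ∀ s → from (to s) ≡ s
  from∘to []          = refl
  from∘to (false ∷ s) = cong (false ∷_) (from∘to s)
  from∘to (true  ∷ s) = cong (true ∷_) (from∘to s)

record Enumeration (A : Set) : Set where
  field
    enum       : ℕ → A
    enumerates : ∀ x → ∃[ n ] enum n ≡ x

open Enumeration

ℕ-enumeration : Enumeration ℕ
ℕ-enumeration = record { enum = id ; enumerates = λ n → n , refl }

Node-enumeration : Enumeration Node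
Node-enumeration = record
  { enum       = Inverse.from Node↔ℕ
  ; enumerates = λ s → Inverse.to Node↔ℕ s , Inverse.strictlyInverseʳ Node↔ℕ s
  }

Bool×Node-enumeration : Enumeration (Bool × Node)
Bool×Node-enumeration = record
  { enum       = pair ∘ enum Node-enumeration
  ; enumerates = λ (b , s) → let n , e = enumerates Node-enumeration (b ∷ s) in
      n , cong pair {y = b ∷ s} e
  }
  where
  pair : Node → Bool × Node
  -- An arbitrary value; the nonempty words already give all pairs.
  pair []      = true , []
  pair (b ∷ s) = b , s

module _ {X : Set} where

  Open-∃ : {I : Set} {U : I → Pred (X → Bool) 0ℓ} → (∀ i → Open (U i)) → Open (λ χ → ∃[ i ] χ ∈ U i)
  Open-∃ o χ (i , u) = let F , nbhd = o i χ u in F , λ ψ agree → i , nbhd ψ agree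

  Open-∩ : {U V : Pred (X → Bool) 0ℓ} → Open U → Open V → Open (U ∩ V)
  Open-∩ o p χ (u , v) = let F , f = o χ u ; G , g = p χ v in
    F ++ G , λ ψ agree → f ψ (++⁻ˡ F agree) , g ψ (++⁻ʳ F agree)

  Open-∋ : ∀ x → Open {X} (λ χ → T (χ x))
  Open-∋ x χ t = x ∷ [] , λ { ψ (e ∷ []) → subst T (sym e) t }

  Open-resp : {U V : Pred (X → Bool) 0ℓ} → U ≐ V → Open U → Open V
  Open-resp (U⊆V , V⊆U) o χ v = let F , nbhd = o χ (V⊆U v) in F , λ ψ → U⊆V ∘ nbhd ψ

  Σ⁰-resp : ∀ {n} {U V : Pred (X → Bool) 0ℓ} → U ≐ V → Σ⁰ n U → Σ⁰ n V
  Σ⁰-resp eq (isOpen o)                              = isOpen (Open-resp eq o)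
  Σ⁰-resp (U⊆V , V⊆U) (⋃Π⁰ m W m<n σ (U⊆W , W⊆U)) = ⋃Π⁰ m W m<n σ (U⊆W ∘ V⊆U , U⊆V ∘ W⊆U)

-- The complexity of the ideal.

Above : ℕ → Node → Pred (Node → Bool) 0ℓ
Above l u χ = ∃[ t ] l ℕ.≤ length t × u ⊑ t × T (χ t)

Open-Above : ∀ l u → Open (Above l u)
Open-Above l u = Open-∃ λ t → Open-∃ λ _ → Open-∃ λ _ → Open-∋ t

module _ (em : ExcludedMiddle 0ℓ) where

  -- Complementing and then taking a countable union costs one rank, so the rank of a formula is
  -- found by counting quantifiers of the form ∃¬.
  Σ⁰-∃¬ : {X I : Set} → Enumeration I → ∀ {n} (m : I → ℕ) (U : I → Pred (X → Bool) 0ℓ) →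
          (∀ i → m i ℕ.< n) → (∀ i → Σ⁰ (m i) (U i)) → Σ⁰ n (λ χ → ∃[ i ] χ ∉ U i)
  Σ⁰-∃¬ e m U m<n σ = ⋃Π⁰ (m ∘ enum e) (λ k → ∁ (U (enum e k))) (m<n ∘ enum e)
    (λ k → Σ⁰-resp ((λ u n → n u) , dne em) (σ (enum e k)))
    ( (λ {χ} (i , u) → let k , eq = enumerates e i in k , subst (λ i → χ ∉ U i) (sym eq) u)
    , λ (k , u) → enum e k , u)

  Live : 𝒫 Node → 𝒫 Node
  Live A u = ¬ Bounded (A ∩ cone u)

  -- The word `x` has two uses: it is the node that must not split, and its length is a gap number.
  -- One quantifier over words thus covers both conditions.
  record Thin (A : 𝒫 Node) (N : ℕ) (x : Node) : Set where
    field
      unsplit : N ℕ.≤ length x → ¬ (Live A (false ∷ x) × Live A (true ∷ x))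
      gapless : N ℕ.≤ length x → Bounded (λ s → s ∈ A × Live A (s ▹ length x))

  open Thin

  -- Live nodes lie on the listed branches. Two branches part at most once, so splitting nodes have
  -- bounded length, and the gap conditions of finitely many branches combine.
  𝓘⇒Thin : ∀ {A} → A ∈ 𝓘 → ∃[ N ] (∀ x → Thin A N x)
  𝓘⇒Thin {A} a = proj₁ unsplits ⊔ proj₁ gapsL , λ x → record
    { unsplit = λ l (p , q) → proj₂ unsplits x (≤-trans (m≤m⊔n _ _) l)
        (Any.map (λ p → Any.map (λ q → p , q) (live⇒≺ q)) (live⇒≺ p))
    ; gapless = λ l → Bounded-⊆ (λ (s∈A , p) → Any.map (s∈A ,_) (live⇒≺ p))
        (proj₂ gapsL (length x) (≤-trans (m≤n⊔m _ _) l))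
    }
    where
    L = branches a

    live⇒≺ : ∀ {u} → Live A u → Any (u ≺_) L
    live⇒≺ {u} live = dne em λ none → live (Bounded-⊆
      (λ (s∈A , u⊑s) → s∈A , none ∘ Any.map (λ p → res⊑-≺ p u⊑s)) (converge a (length u)))

    disjoint : ∀ α β → Bounded (λ u → false ∷ u ≺ α × true ∷ u ≺ β)
    disjoint α β with em {∃[ u ] false ∷ u ≺ α × true ∷ u ≺ β}
    ... | no  none         = 0 , λ u _ p → none (u , p)
    ... | yes (v , vα , vβ) = suc (length v) , λ u v<u (uα , uβ) → false∷≢true∷
      (trans (sym vα) (trans
        (res-≡ (≺-res⊑ (⊑-≺ (step stop) uα) v<u) (≺-res⊑ (⊑-≺ (step stop) uβ) v<u)) vβ))
      where
      false∷≢true∷ : ¬ false ∷ v ≡ true ∷ v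
      false∷≢true∷ ()

    unsplits : Bounded (λ u → Any (λ α → Any (λ β → false ∷ u ≺ α × true ∷ u ≺ β) L) L)
    unsplits = Bounded-Any L λ α _ → Bounded-Any L λ β _ → disjoint α β

    gapsL : EventuallyBounded (λ k s → Any (λ α → s ∈ A × s ▹ k ≺ α) L)
    gapsL = EventuallyBounded-Any L (gaps a)

  -- From level `N` on live nodes do not split, so each live node of that level carries a single
  -- branch, and the level has finitely many nodes.
  Thin⇒𝓘 : ∀ {A} N → (∀ x → Thin A N x) → A ∈ 𝓘
  Thin⇒𝓘 {A} N thin = record
    { branches = proj₁ all-branches
    ; converge = λ m → Bounded-⊆ (λ (s∈A , p) → s∈A , []⊑ _ , p) (proj₂ all-branches m)
    ; gaps     = gaps′
    }
    where
    CoversAbove : Node → List Branch → Set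
    CoversAbove u L = ∀ m → Bounded (λ s → s ∈ A × u ⊑ s × ¬ Any (λ α → res α m ⊑ s) L)

    live-⊑ : ∀ {u v} → u ⊑ v → Live A v → Live A u
    live-⊑ p live b = live (Bounded-⊆ (λ (s∈A , q) → s∈A , ⊑-trans p q) b)

    live-child : ∀ {u} → Live A u → ∃[ b ] Live A (b ∷ u)
    live-child {u} live = dne em λ none → live (Bounded-beyond (suc (length u)) (Bounded-⊆ split
      (Bounded-∪ (dne em (λ n → none (false , n))) (dne em (λ n → none (true , n))))))
      where
      split : ∀ {s} → (s ∈ A × u ⊑ s) × length u ℕ.< length s →
              s ∈ (A ∩ cone (false ∷ u)) ∪ (A ∩ cone (true ∷ u))
      split ((s∈A , p) , l) with ⊑-child p
      ... | inj₁ refl        = contradiction l (ℕ.<-irrefl refl)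
      ... | inj₂ (false , q) = inj₁ (s∈A , q)
      ... | inj₂ (true  , q) = inj₂ (s∈A , q)

    -- Comparability with `u` forces a branch through these words to pass through `u`.
    Along : Node → 𝒫 Node
    Along u s = Live A s × (s ⊑ u ⊎ u ⊑ s)

    along-child : ∀ {u} → Live A u → ∀ s → s ∈ Along u → ∃[ b ] (b ∷ s) ∈ Along u
    along-child live s (live-s , inj₂ p) = let b , q = live-child live-s in b , q , inj₂ (step p)
    along-child live s (live-s , inj₁ p) with ⊑-child p
    ... | inj₁ refl    = let b , q = live-child live in b , q , inj₂ (step stop)
    ... | inj₂ (b , q) = b , live-⊑ q live , inj₁ q

    sibling-dead : ∀ {u} b → N ℕ.≤ length u → Live A (b ∷ u) → Bounded (A ∩ cone (not b ∷ u))
    sibling-dead {u} false l p = dne em λ q → unsplit (thin u) l (p , q)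
    sibling-dead {u} true  l p = dne em λ q → unsplit (thin u) l (q , p)

    -- By induction on the level `m`: words that leave `α` right after level `m` lie above the
    -- sibling of a live node, which is dead, so only a bounded set is lost.
    above-live : ∀ {u} → N ℕ.≤ length u → Live A u → ∃[ α ] CoversAbove u [ α ]
    above-live {u} N≤u live = α , covers
      where
      path = branch em (Along u) (live-⊑ ([]⊑ u) live , inj₁ ([]⊑ u)) (along-child live)
      α = proj₁ path

      u≺α : u ≺ α
      u≺α with proj₂ (proj₂ path (length u))
      ... | inj₁ p = ⊑-≡ p (ℕ.≤-reflexive (sym (length-res α _)))
      ... | inj₂ p = sym (⊑-≡ p (ℕ.≤-reflexive (length-res α _)))

      covers : CoversAbove u [ α ]
      covers zero    = 0 , λ s _ (_ , _ , n) → n (here ([]⊑ s))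
      covers (suc m) with ℕ.<-≤-connex m (length u)
      ... | inj₁ m<u = 0 , λ s _ (_ , u⊑s , n) → n (here (⊑-trans (≺-res⊑ u≺α m<u) u⊑s))
      ... | inj₂ u≤m = Bounded-beyond (suc m) (Bounded-⊆ split (Bounded-∪ (covers m) off))
        where
        w = res α m

        off : Bounded (A ∩ cone (not (α m) ∷ w))
        off = sibling-dead (α m)
          (≤-trans N≤u (≤-trans u≤m (ℕ.≤-reflexive (sym (length-res α m)))))
          (proj₁ (proj₂ path (suc m)))

        branching : ∀ {s} → w ⊑ s → m ℕ.< length s → α m ∷ w ⊑ s ⊎ not (α m) ∷ w ⊑ s
        branching p m<s with ⊑-child p
        ... | inj₁ refl    = contradiction (subst (m ℕ.<_) (length-res α m) m<s) (ℕ.<-irrefl refl)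
        ... | inj₂ (c , q) with c Bool.≟ α m
        ...   | yes refl = inj₁ q
        ...   | no  c≢   = inj₂ (subst (λ c → c ∷ w ⊑ _) (Bool.¬-not c≢) q)

        split : ∀ {s} → (s ∈ A × u ⊑ s × ¬ Any (λ α → res α (suc m) ⊑ s) [ α ]) × m ℕ.< length s →
                (s ∈ A × u ⊑ s × ¬ Any (λ α → res α m ⊑ s) [ α ]) ⊎ s ∈ A ∩ cone (not (α m) ∷ w)
        split {s} ((s∈A , p , n) , m<s) with em {w ⊑ s}
        ... | no ¬q = inj₁ (s∈A , p , λ { (here q) → ¬q q })
        ... | yes q with branching q m<s
        ...   | inj₁ r = ⊥-elim (n (here r))
        ...   | inj₂ r = inj₂ (s∈A , r)

    -- Recursion on the number `d` of levels that may remain below level `N`; the lists of the two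
    -- children are joined.
    covers-above : ∀ d u → N ℕ.≤ d ℕ.+ length u → ∃ (CoversAbove u)
    covers-above zero    u l with em {Bounded (A ∩ cone u)}
    ... | yes b   = [] , λ m → Bounded-⊆ (λ (s∈A , p , _) → s∈A , p) b
    ... | no live = let α , c = above-live l live in [ α ] , c
    covers-above (suc d) u l = L₀ ++ L₁ , λ m → Bounded-beyond (suc (length u))
      (Bounded-⊆ split (Bounded-∪ (c₀ m) (c₁ m)))
      where
      child = λ b → covers-above d (b ∷ u) (≤-trans l (ℕ.≤-reflexive (sym (ℕ.+-suc d (length u)))))
      L₀ = proj₁ (child false)
      L₁ = proj₁ (child true)
      c₀ = proj₂ (child false)
      c₁ = proj₂ (child true)

      split : ∀ {m s} → (s ∈ A × u ⊑ s × ¬ Any (λ α → res α m ⊑ s) (L₀ ++ L₁)) × length u ℕ.< length s →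
              (s ∈ A × false ∷ u ⊑ s × ¬ Any (λ α → res α m ⊑ s) L₀) ⊎
              (s ∈ A × true ∷ u ⊑ s × ¬ Any (λ α → res α m ⊑ s) L₁)
      split ((s∈A , p , n) , l) with ⊑-child p
      ... | inj₁ refl        = contradiction l (ℕ.<-irrefl refl)
      ... | inj₂ (false , q) = inj₁ (s∈A , q , n ∘ ++⁺ˡ)
      ... | inj₂ (true  , q) = inj₂ (s∈A , q , n ∘ ++⁺ʳ L₀)

    all-branches : ∃ (CoversAbove [])
    all-branches = covers-above N [] (ℕ.m≤m+n N 0)

    gaps′ : ∀ α → EventuallyBounded (λ k s → s ∈ A × s ▹ k ≺ α)
    gaps′ α with em {∃[ n ] Bounded (A ∩ cone (res α n))}
    ... | yes (n , b) = 0 , λ k _ → Bounded-beyond n (Bounded-⊆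
      (λ {s} ((s∈A , p) , n≤s) → s∈A , ≺-res⊑ (⊑-≺ (⊑-▹ s k) p) n≤s) b)
    -- All prefixes of `α` are live, so `gapless` applies; it sees only the length of its word, and
    -- 0ᵏ is a word of length `k`.
    ... | no all-live = N , λ k N≤k → subst (λ n → Bounded (λ s → s ∈ A × s ▹ n ≺ α)) (length-replicate k)
      (Bounded-⊆ (λ {s} (s∈A , p) → s∈A , λ b → all-live (length (s ▹ length (replicate k false)) ,
                    subst (λ v → Bounded (A ∩ cone v)) (sym p) b))
        (gapless (thin (replicate k false)) (≤-trans N≤k (ℕ.≤-reflexive (sym (length-replicate k))))))

  -- Liveness of `u` is the intersection over `l` of the open sets `Above l u`, hence Π⁰₂.
  Live⇒Above : ∀ {χ u} → Live (T ∘ χ) u → ∀ l → χ ∈ Above l u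
  Live⇒Above live l = dne em λ none → live (l , λ s l≤s (t , p) → none (s , l≤s , p , t))

  Above⇒Live : ∀ {χ u} → (∀ l → χ ∈ Above l u) → Live (T ∘ χ) u
  Above⇒Live above (l , b) = let s , l≤s , p , t = above l in b s l≤s (t , p)

  Split : ℕ → Node → ℕ → Pred (Node → Bool) 0ℓ
  Split N x l = (λ χ → N ℕ.≤ length x × χ ∈ Above l (false ∷ x)) ∩ Above l (true ∷ x)

  Gap : ℕ → Node → ℕ → Node → ℕ → Pred (Node → Bool) 0ℓ
  Gap N x m s l = (λ χ → (N ℕ.≤ length x × m ℕ.≤ length s) × T (χ s)) ∩ Above l (s ▹ length x)

  -- A formula for Thin in which only quantifiers ∃¬ are used above open sets; the boolean
  -- merges its two clauses into a single universal quantification.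
  ThinFormula : ℕ → Bool × Node → Pred (Node → Bool) 0ℓ
  ThinFormula N (true  , x) χ = ∃[ l ] χ ∉ Split N x l
  ThinFormula N (false , x) χ = ∃[ m ] χ ∉ λ χ → ∃[ s ] χ ∉ λ χ → ∃[ l ] χ ∉ Gap N x m s l

  -- `Split` and `Gap` are open. One ∃¬ gives rank 2 for the first clause, three give rank 4 for the
  -- second, and the outer one gives 5.
  Σ⁰-ThinFormula : ∀ N → Σ⁰ 5 (λ χ → ∃[ i ] χ ∉ ThinFormula N i)
  Σ⁰-ThinFormula N = Σ⁰-∃¬ Bool×Node-enumeration level (ThinFormula N) level<5 λ
    { (true  , x) → Σ⁰-∃¬ ℕ-enumeration (λ _ → 1) (Split N x) (λ _ → ≤-refl) λ l →
        isOpen (Open-∩ (Open-∃ λ _ → Open-Above l _) (Open-Above l _))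
    ; (false , x) →
        Σ⁰-∃¬ ℕ-enumeration (λ _ → 3) _ (λ _ → ≤-refl) λ m →
        Σ⁰-∃¬ Node-enumeration (λ _ → 2) _ (λ _ → ≤-refl) λ s →
        Σ⁰-∃¬ ℕ-enumeration (λ _ → 1) (Gap N x m s) (λ _ → ≤-refl) λ l →
        isOpen (Open-∩ (Open-∃ λ _ → Open-∋ s) (Open-Above l _)) }
    where
    level : Bool × Node → ℕ
    level (true  , _) = 2
    level (false , _) = 4

    level<5 : ∀ i → level i ℕ.< 5
    level<5 (true  , _) = s≤s (s≤s (s≤s z≤n))
    level<5 (false , _) = ≤-refl

  Thin⇒formula : ∀ {χ N} → (∀ x → Thin (T ∘ χ) N x) → ∀ i → χ ∈ ThinFormula N i
  Thin⇒formula {χ} {N} thin (true , x) = dne em λ none →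
    let split = ¬∃¬⇒∀ em (λ l → χ ∈ Split N x l) none in
    unsplit (thin x) (proj₁ (proj₁ (split 0)))
      (Above⇒Live (proj₂ ∘ proj₁ ∘ split) , Above⇒Live (proj₂ ∘ split))
  Thin⇒formula {χ} {N} thin (false , x) = bound , λ (s , none) →
    let gap = ¬∃¬⇒∀ em (λ l → χ ∈ Gap N x bound s l) none
        ((N≤x , m≤s) , s∈A) , _ = gap 0
    in bounded N≤x s m≤s (s∈A , Above⇒Live (proj₂ ∘ gap))
    where
    P : 𝒫 Node
    P s = T (χ s) × Live (T ∘ χ) (s ▹ length x)

    guarded : ∃[ m ] (N ℕ.≤ length x → ∀ s → m ℕ.≤ length s → s ∉ P)
    guarded with N ℕ.≤? length x
    ... | yes N≤x = let m , b = gapless (thin x) N≤x in m , λ _ → b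
    -- A bound is demanded even where the guard fails; there any number will do.
    ... | no  N≰x = 0 , λ N≤x → contradiction N≤x N≰x

    bound = proj₁ guarded
    bounded = proj₂ guarded

  formula⇒Thin : ∀ {χ N} → (∀ i → χ ∈ ThinFormula N i) → ∀ x → Thin (T ∘ χ) N x
  formula⇒Thin φ x = record
    { unsplit = λ N≤x (p , q) → let l , n = φ (true , x) in
        n ((N≤x , Live⇒Above p l) , Live⇒Above q l)
    ; gapless = λ N≤x → let m , n = φ (false , x) in
        m , λ s m≤s (s∈A , p) → n (s , λ (l , k) → k (((N≤x , m≤s) , s∈A) , Live⇒Above p l))
    }

  𝓘-Σ⁰₆ : Σ⁰ 6 (charFamily 𝓘)
  𝓘-Σ⁰₆ = Σ⁰-resp
    ( (λ (N , φ) → Thin⇒𝓘 N (formula⇒Thin λ i → dne em λ n → φ (i , n)))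
    , λ a → let N , thin = 𝓘⇒Thin a in N , λ (i , n) → n (Thin⇒formula thin i))
    (Σ⁰-∃¬ ℕ-enumeration (λ _ → 5) _ (λ _ → ≤-refl) Σ⁰-ThinFormula)

-- A sequence taking every value infinitely often.

-- Counts down from m to 0 for m = 0, 1, 2, … in turn, the second component being m; so every
-- number occurs infinitely often as a first component.
countdown : ℕ → ℕ × ℕ
countdown zero    = 0 , 0
countdown (suc n) = advance (countdown n)
  where
  advance : ℕ × ℕ → ℕ × ℕ
  advance (zero  , m) = suc m , suc m
  advance (suc c , m) = c , m

label : ℕ → ℕ
label = proj₁ ∘ countdown

countdown-run : ∀ i {n c m} → countdown n ≡ (i ℕ.+ c , m) → countdown (i ℕ.+ n) ≡ (c , m)
countdown-run zero    e = e
countdown-run (suc i) {n} {c} {m} e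
  rewrite countdown-run i {n} {suc c} (trans e (cong (_, m) (sym (ℕ.+-suc i c)))) = refl

countdown-restart : ∀ j → ∃[ n ] j ℕ.≤ n × countdown n ≡ (j , j)
countdown-restart zero    = 0 , z≤n , refl
countdown-restart (suc j) = let n , j≤n , e = countdown-restart j in
  suc (j ℕ.+ n) , s≤s (ℕ.m≤m+n j n) ,
  restart (j ℕ.+ n) (countdown-run j {n} (trans e (cong (_, j) (sym (ℕ.+-identityʳ j)))))
  where
  restart : ∀ n → countdown n ≡ (0 , j) → countdown (suc n) ≡ (suc j , suc j)
  restart n e rewrite e = refl

label-recurs : ∀ k l → ∃[ n ] l ℕ.≤ n × label n ≡ k
-- The run that starts at `l + k` reaches `k` after `l` steps, so at an index of at least `l`.
label-recurs k l = let n , l≤n , e = countdown-restart (l ℕ.+ k) in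
  l ℕ.+ n , ℕ.m≤m+n l n , cong proj₁ (countdown-run l e)

-- Powers of one half and nested rational intervals.

width : ℕ → ℚ
width zero    = 1ℚ
width (suc n) = ½ ℚ.* width n

width-halves : ∀ n → width (suc n) ℚ.+ width (suc n) ≡ width n
width-halves n = trans (sym (ℚ.*-distribʳ-+ (width n) ½ ½)) (ℚ.*-identityˡ (width n))

-- Unnormalised fractions multiply without cancellation, so the denominator stays visible; `mkℚᵘ`
-- stores it minus one.
width-fraction : ∀ n → ∃[ d ] suc d ≡ 2 ℕ.^ n × ℚ.toℚᵘ (width n) ℚᵘ.≃ mkℚᵘ (+ 1) d
width-fraction zero    = 0 , refl , ℚᵘ.≃-refl
width-fraction (suc n) = let d , e , eq = width-fraction n in
  d ℕ.+ 1 ℕ.* suc d , cong (2 ℕ.*_) e ,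
  ℚᵘ.≃-trans (ℚ.toℚᵘ-homo-* ½ (width n)) (ℚᵘ.*-congˡ {ℚ.toℚᵘ ½} eq)

n<2^n : ∀ n → n ℕ.< 2 ℕ.^ n
n<2^n zero    = s≤s z≤n
n<2^n (suc n) = ≤-trans (s≤s (n<2^n n))
  (ℕ.+-mono-≤ (≤-trans (s≤s z≤n) (n<2^n n)) (ℕ.m≤m+n (2 ℕ.^ n) 0))

width-small : ∀ ε → 0ℚ ℚ.< ε → ∃[ n ] width n ℚ.< ε
-- With `suc e` the denominator of `ε`, 2 to the power `- suc e` is below `1 / suc e`, which is at
-- most `ε`.
width-small ε@(mkℚ +[1+ p ] e _) 0<ε = suc e , (
  let d , eq , w≃ = width-fraction (suc e) in
  ℚ.toℚᵘ-cancel-< (ℚᵘ.<-respˡ-≃ (ℚᵘ.≃-sym w≃) (*<* (ℤ.+<+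
    (≤-trans (s≤s (ℕ.≤-reflexive (cong suc (ℕ.+-identityʳ e))))
      (≤-trans (subst (suc (suc e) ℕ.≤_) (sym eq) (n<2^n (suc e))) (ℕ.m≤m+n (suc d) (p ℕ.* suc d))))))))
width-small (mkℚ (+ 0) _ _) (ℚ.*<* (ℤ.+<+ ()))
width-small (mkℚ ℤ.-[1+ _ ] _ _) (ℚ.*<* ())

width≥0 : ∀ n → 0ℚ ℚ.≤ width n
width≥0 zero    = ℚ.*≤* (ℤ.+≤+ z≤n)
width≥0 (suc n) = subst (ℚ._≤ width (suc n)) (ℚ.*-zeroʳ ½)
  (ℚ.*-monoˡ-≤-nonNeg ½ (width≥0 n))

x≤x+ : ∀ x {y} → 0ℚ ℚ.≤ y → x ℚ.≤ x ℚ.+ y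
x≤x+ x {y} 0≤y = subst (ℚ._≤ x ℚ.+ y) (ℚ.+-identityʳ x) (ℚ.+-monoʳ-≤ x 0≤y)

x<x+ : ∀ x {y} → 0ℚ ℚ.< y → x ℚ.< x ℚ.+ y
x<x+ x {y} 0<y = subst (ℚ._< x ℚ.+ y) (ℚ.+-identityʳ x) (ℚ.+-monoʳ-< x 0<y)

[x+y]-y : ∀ x y → (x ℚ.+ y) ℚ.- y ≡ x
[x+y]-y x y = trans (ℚ.+-assoc x y (ℚ.- y))
  (trans (cong (x ℚ.+_) (ℚ.+-inverseʳ y)) (ℚ.+-identityʳ x))

[x-y]+y : ∀ x y → (x ℚ.- y) ℚ.+ y ≡ x
[x-y]+y x y = trans (ℚ.+-assoc x (ℚ.- y) y)
  (trans (cong (x ℚ.+_) (ℚ.+-inverseˡ y)) (ℚ.+-identityʳ x))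

<-+⇒-< : ∀ {x y z} → x ℚ.< y ℚ.+ z → x ℚ.- z ℚ.< y
<-+⇒-< {x} {y} {z} p = subst (x ℚ.- z ℚ.<_) ([x+y]-y y z) (ℚ.+-monoˡ-< (ℚ.- z) p)

0<- : ∀ {q r} → q ℚ.< r → 0ℚ ℚ.< r ℚ.- q
0<- {q} {r} q<r = subst (ℚ._< r ℚ.- q) (ℚ.+-inverseʳ q) (ℚ.+-monoˡ-< (ℚ.- q) q<r)

module NestedIntervals (a : ℕ → ℚ)
  (left  : ∀ n → a n ℚ.≤ a (suc n))
  (right : ∀ n → a (suc n) ℚ.+ width (suc n) ℚ.≤ a n ℚ.+ width n) where

  b : ℕ → ℚ
  b n = a n ℚ.+ width n

  left-mono : ∀ {m n} → m ℕ.≤′ n → a m ℚ.≤ a n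
  left-mono (ℕ.≤′-reflexive refl) = ℚ.≤-refl
  left-mono (ℕ.≤′-step p)         = ℚ.≤-trans (left-mono p) (left _)

  right-anti : ∀ {m n} → m ℕ.≤′ n → b n ℚ.≤ b m
  right-anti (ℕ.≤′-reflexive refl) = ℚ.≤-refl
  right-anti (ℕ.≤′-step p)         = ℚ.≤-trans (right _) (right-anti p)

  left≤right : ∀ m n → a m ℚ.≤ b n
  left≤right m n = ℚ.≤-trans (left-mono (ℕ.≤⇒≤′ (m≤m⊔n m n)))
    (ℚ.≤-trans (x≤x+ _ (width≥0 (m ⊔ n))) (right-anti (ℕ.≤⇒≤′ (m≤n⊔m m n))))

  limit : ℝ
  limit = record
    { lower           = λ q → ∃[ n ] q ℚ.< a n
    ; upper           = λ q → ∃[ n ] b n ℚ.< q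
    ; lower-inhabited = a 0 ℚ.- 1ℚ , 0 , <-+⇒-< (x<x+ (a 0) 0<1)
    ; upper-inhabited = b 0 ℚ.+ 1ℚ , 0 , x<x+ (b 0) 0<1
    ; lower-rounded   = λ q → mk⇔
        (λ (n , q<a) → let r , q<r , r<a = ℚ.<-dense q<a in r , q<r , n , r<a)
        (λ (r , q<r , n , r<a) → n , ℚ.<-trans q<r r<a)
    ; upper-rounded   = λ q → mk⇔
        (λ (n , b<q) → let r , b<r , r<q = ℚ.<-dense b<q in r , r<q , n , b<r)
        (λ (r , r<q , n , b<r) → n , ℚ.<-trans b<r r<q)
    ; disjoint        = λ q ((m , q<a) , (n , b<q)) →
        ℚ.<-irrefl refl (ℚ.<-≤-trans (ℚ.<-trans b<q q<a) (left≤right m n))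
    ; located         = located
    }
    where
    0<1 : 0ℚ ℚ.< 1ℚ
    0<1 = ℚ.*<* (ℤ.+<+ (s≤s z≤n))

    -- Take an interval shorter than `r - q`: if its left end is at most `q`, its right end is below
    -- `r`.
    located : ∀ q r → q ℚ.< r → (∃[ n ] q ℚ.< a n) ⊎ (∃[ n ] b n ℚ.< r)
    located q r q<r with width-small (r ℚ.- q) (0<- q<r)
    ... | n , small with q ℚ.<? a n
    ...   | yes q<a = inj₁ (n , q<a)
    ...   | no  q≮a = inj₂ (n , subst (b n ℚ.<_)
      (trans (ℚ.+-comm q _) ([x-y]+y r q)) (ℚ.+-mono-≤-< (ℚ.≮⇒≥ q≮a) small))

  module _ (s : ℕ → ℚ[0,1])
    (inside : ∀ n → a n ℚ.≤ proj₁ (s n) × proj₁ (s n) ℚ.≤ b n) where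

    -- From index `N` on, the terms and the limit share the `N`-th interval, which is shorter than
    -- `ε`.
    converges : s ConvergesTo limit
    converges ε 0<ε = let N , small = width-small ε 0<ε in N , λ n N≤n →
      (N , <-+⇒-< (ℚ.≤-<-trans (proj₂ (inside n))
             (ℚ.≤-<-trans (right-anti (ℕ.≤⇒≤′ N≤n)) (ℚ.+-monoʳ-< (a N) small)))) ,
      (N , ℚ.<-≤-trans (ℚ.+-monoʳ-< (a N) small)
             (ℚ.+-monoˡ-≤ ε (ℚ.≤-trans (left-mono (ℕ.≤⇒≤′ N≤n)) (proj₁ (inside n)))))

    convergent : Convergent s
    convergent = limit ,
      ( (λ (n , b<0) → ℚ.<-irrefl refl
          (ℚ.≤-<-trans (ℚ.≤-trans (proj₁ (proj₂ (s n))) (proj₂ (inside n))) b<0))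
      , (λ (n , 1<a) → ℚ.<-irrefl refl
          (ℚ.<-≤-trans 1<a (ℚ.≤-trans (proj₁ (inside n)) (proj₂ (proj₂ (s n)))))) ) ,
      converges

-- The ideal is not Katětov above `conv`.

module _ (em : ExcludedMiddle 0ℓ) where

  -- The prefixes of members of the chain form a tree, without leaves because the lengths are
  -- unbounded; its branch is the union of the chain.
  chain-≺ : (node : ℕ → Node) → (∀ n → node n ⊑ node (suc n)) → (∀ n → n ℕ.≤ length (node n)) →
            ∃[ α ] (∀ n → node n ≺ α)
  chain-≺ node grow long = α , λ n → let m , p = below (length (node n)) in
      res⊑-≺ (⊑-trans p (chain (m≤m⊔n m n))) (chain (m≤n⊔m m n))
    where
    chain′ : ∀ {m n} → m ℕ.≤′ n → node m ⊑ node n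
    chain′ (ℕ.≤′-reflexive refl) = stop
    chain′ (ℕ.≤′-step p)         = ⊑-trans (chain′ p) (grow _)

    chain : ∀ {m n} → m ℕ.≤ n → node m ⊑ node n
    chain = chain′ ∘ ℕ.≤⇒≤′

    Below : 𝒫 Node
    Below u = ∃[ n ] u ⊑ node n

    extend : ∀ u → u ∈ Below → ∃[ b ] (b ∷ u) ∈ Below
    extend u (n , p) with ⊑-child (⊑-trans p (chain (m≤m⊔n n (suc (length u)))))
    ... | inj₂ (b , q) = b , _ , q
    ... | inj₁ e       = contradiction
      (≤-trans (m≤n⊔m n (suc (length u))) (≤-trans (long _) (ℕ.≤-reflexive (cong length e)))) ℕ.1+n≰n

    path = branch em Below (0 , []⊑ _) extend
    α = proj₁ path
    below = proj₂ path

  module _ (f : Node → ℚ[0,1]) where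

    value : Node → ℚ
    value u = proj₁ (f u)

    Dense : ℚ → ℚ → Node → Set
    Dense x y s = ∀ t → s ⊑ t → ∃[ u ] t ⊑ u × x ℚ.≤ value u × value u ℚ.≤ y

    -- A set of values dense above s, cut into two, has a half that is dense above some t ⊒ s.
    dense-halve : ∀ {x y s} z → Dense x y s → Dense x z s ⊎ (∃[ t ] s ⊑ t × Dense z y t)
    dense-halve {x} {y} {s} z dense with em {Dense x z s}
    ... | yes p = inj₁ p
    ... | no ¬p = inj₂ (upper (¬∀⇒∃¬ em ¬p))
      where
      upper : ∃[ t ] ¬ (s ⊑ t → ∃[ u ] t ⊑ u × x ℚ.≤ value u × value u ℚ.≤ z) →
              ∃[ t ] s ⊑ t × Dense z y t
      upper (t , n) = t , s⊑t , λ t′ t⊑t′ →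
        let u , t′⊑u , x≤u , u≤y = dense t′ (⊑-trans s⊑t t⊑t′) in
        u , t′⊑u , [ id , (λ u≤z → ⊥-elim (n λ _ → u , ⊑-trans t⊑t′ t′⊑u , x≤u , u≤z)) ]′
                     (ℚ.≤-total z (value u)) , u≤y
        where
        s⊑t = dne em λ ¬q → n (⊥-elim ∘ ¬q)

    record Stage (n : ℕ) : Set where
      field
        node  : Node
        left  : ℚ
        dense : Dense left (left ℚ.+ width n) node

    open Stage

    record Step {n} (S : Stage n) : Set where
      field
        point  : Node
        above  : node S ⊑ point
        inside : left S ℚ.≤ value point × value point ℚ.≤ left S ℚ.+ width n
        next   : Stage (suc n)
        gap    : point ▹ label n ⊑ node next
        left≤  : left S ℚ.≤ left next
        right≤ : left next ℚ.+ width (suc n) ℚ.≤ left S ℚ.+ width n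

    open Step

    -- The point and its gap are fixed before the interval is halved, since the chosen half may be
    -- dense only above a longer word.
    advance : ∀ {n} (S : Stage n) → Step S
    advance {n} S = choose (dense-halve (x ℚ.+ w) dense′)
      where
      x = left S
      w = width (suc n)
      found = dense S (node S) stop
      u = proj₁ found
      v = u ▹ label n

      S⊑v : node S ⊑ v
      S⊑v = ⊑-trans (proj₁ (proj₂ found)) (⊑-▹ u (label n))

      whole : (x ℚ.+ w) ℚ.+ w ≡ x ℚ.+ width n
      whole = trans (ℚ.+-assoc x w w) (cong (x ℚ.+_) (width-halves n))

      dense′ : Dense x ((x ℚ.+ w) ℚ.+ w) v
      dense′ = subst (λ y → Dense x y v) (sym whole) λ t v⊑t → dense S t (⊑-trans S⊑v v⊑t)

      choose : Dense x (x ℚ.+ w) v ⊎ (∃[ t ] v ⊑ t × Dense (x ℚ.+ w) ((x ℚ.+ w) ℚ.+ w) t) → Step S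
      choose (inj₁ d) = record
        { point = u ; above = proj₁ (proj₂ found) ; inside = proj₂ (proj₂ found)
        ; next = record { node = v ; left = x ; dense = d }
        ; gap = stop ; left≤ = ℚ.≤-refl
        ; right≤ = ℚ.≤-trans (x≤x+ _ (width≥0 (suc n))) (ℚ.≤-reflexive whole)
        }
      choose (inj₂ (t , v⊑t , d)) = record
        { point = u ; above = proj₁ (proj₂ found) ; inside = proj₂ (proj₂ found)
        ; next = record { node = t ; left = x ℚ.+ w ; dense = d }
        ; gap = v⊑t ; left≤ = x≤x+ x (width≥0 (suc n)) ; right≤ = ℚ.≤-reflexive whole
        }

    stage : ∀ n → Stage n
    stage zero    = record
      -- The first interval is all of [0,1], so every word is its own witness of density.
      { node = [] ; left = 0ℚ ; dense = λ t _ → t , stop , proj₂ (f t) }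
    stage (suc n) = next (advance (stage n))

    points : ℕ → Node
    points n = point (advance (stage n))

    points-▹ : ∀ n → points n ▹ label n ⊑ node (stage (suc n))
    points-▹ n = gap (advance (stage n))

    long : ∀ n → n ℕ.≤ length (points n)
    nodes-long : ∀ n → n ℕ.≤ length (node (stage n))
    long n = ≤-trans (nodes-long n) (⊑-length (above (advance (stage n))))
    nodes-long zero    = z≤n
    nodes-long (suc n) = ≤-trans (s≤s (long n)) (≤-trans
      (≤-trans (s≤s (ℕ.m≤n+m _ (label n))) (ℕ.≤-reflexive (sym (length-▹ (points n) (label n)))))
      (⊑-length (points-▹ n)))

    convergent-subsequence : Convergent (f ∘ points) × (∃[ α ] (∀ n → points n ▹ label n ≺ α))
    convergent-subsequence =
      NestedIntervals.convergent (left ∘ stage) (left≤ ∘ advance ∘ stage) (right≤ ∘ advance ∘ stage)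
        (f ∘ points) (inside ∘ advance ∘ stage) ,
      let α , p = chain-≺ (node ∘ stage)
            (λ n → ⊑-trans (above (advance (stage n))) (⊑-trans (⊑-▹ _ _) (points-▹ n))) nodes-long
      in α , λ n → ⊑-≺ (points-▹ n) (p (suc n))

  -- The preimage of the convergent sequence contains all points. At `α` some gap `K` would admit
  -- only boundedly many of them, but `label` equals `K` at arbitrarily late, hence arbitrarily
  -- long, points.
  conv≰𝓘 : ¬ conv ≤K 𝓘
  conv≰𝓘 (f , reduces) = proj₂ bounded (points f n) (≤-trans l≤n (long f n))
      ((n , refl) , subst (λ k → points f n ▹ k ≺ α) n↦K (p n))
    where
    s = f ∘ points f
    converging = convergent-subsequence f
    α = proj₁ (proj₂ converging)
    p = proj₂ (proj₂ converging)

    small : (f ⊢ range s) ∈ 𝓘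
    small = reduces (range s) (1 , (λ _ → s) , (λ _ → proj₁ converging) , λ r → fzero , r)

    K = proj₁ (gaps small α)
    bounded = proj₂ (gaps small α) K ≤-refl
    occurrence = label-recurs K (proj₁ bounded)
    n = proj₁ occurrence
    l≤n = proj₁ (proj₂ occurrence)
    n↦K = proj₂ (proj₂ occurrence)

  𝓘-isIdeal : IsIdeal 𝓘
  𝓘-isIdeal = record
    { downward = 𝓘-downward
    ; union    = 𝓘-union
    ; finite   = 𝓘-finite
    -- If every set were in `𝓘`, any map, such as a constant one, would reduce `conv` to it.
    ; proper   = λ all → conv≰𝓘 ((λ _ → 0ℚ , ℚ.≤-refl , width≥0 0) , λ A _ → all (_ ⊢ A))
    }

theorem3p4 : (∀ {ℓ} → ExcludedMiddle ℓ) →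
    Σ[ X ∈ Set ] (X ↔ ℕ) ×
    (Σ[ I ∈ Pred (𝒫 X) 0ℓ ]
    IsIdeal I ×
    Σ⁰ 6 (charFamily I) ×
    ¬ (Σ[ J ∈ Pred (𝒫 X) 0ℓ ] IsP⁺Ideal J × I ⊆ J) ×
    ¬ (conv ≤K I))
theorem3p4 em = Node , Node↔ℕ , 𝓘 , 𝓘-isIdeal em , 𝓘-Σ⁰₆ em , not-extendable em , conv≰𝓘 em
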